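{- Let $G$ be the line graph of a bipartite graph. Then $p(G)\le 2$.
   Context: The line graph of a graph $H$ has the edges of $H$ as vertices, two being adjacent iff the corresponding edges of $H$ share a vertex. A comparability graph is a graph admitting a transitive orientation. $p(G)$ is the minimum number $m$ such that $E(G)$ is the union of the edge sets of $m$ pairwise edge-disjoint comparability subgraphs of $G$. -}

module Defs where

open import Data.Bool.Base using (Bool)
open import Data.Fin.Base using (Fin; _<_)
open import Data.Fin.Properties using (_≟_; any?)
open import Data.Nat.Base using (ℕ; _≤_)
open import Data.Product.Base using (Σ-syntax; ∃-syntax; _×_; _,_)
open import Data.Sum.Base using (_⊎_)
open import Function.Base using (_∘_)
open import Level using (0ℓ)
open import Relation.Binary.Core using (Rel)
open import Relation.Binary.Definitions
  using (Symmetric; Irreflexive; Transitive; Asymmetric; Decidable; DecidableEquality)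
open import Relation.Binary.PropositionalEquality using (_≡_; _≢_; refl; sym; cong)
open import Relation.Nullary.Decidable using (yes; no; ¬?; _×-dec_; _⊎-dec_)
open import Relation.Nullary.Negation using (¬_)

record Graph (V : Set) : Set₁ where
  infix 4 _~_ _~?_
  field
    _~_    : Rel V 0ℓ
    _~?_   : Decidable _~_
    symm   : Symmetric _~_
    irrefl : Irreflexive _≡_ _~_

Bipartite : {V : Set} → Graph V → Set
Bipartite {V} H = Σ[ side ∈ (V → Bool) ] (∀ {u v} → u ~ v → side u ≢ side v)
  where open Graph H

-- An unordered edge is stored once, with its endpoints in increasing order.
-- The proofs are irrelevant, so edges with the same endpoints are equal.
record Edge {n : ℕ} (H : Graph (Fin n)) : Set where
  constructor edge
  field
    fst snd  : Fin n
    .fst<snd : fst < snd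
    .adj     : Graph._~_ H fst snd

module _ {n : ℕ} {H : Graph (Fin n)} where

  open Edge

  infix 4 _∈ᴱ_ _≟ᴱ_

  _∈ᴱ_ : Fin n → Edge H → Set
  x ∈ᴱ e = x ≡ fst e ⊎ x ≡ snd e

  ShareVertex : Rel (Edge H) 0ℓ
  ShareVertex e f = ∃[ x ] (x ∈ᴱ e × x ∈ᴱ f)

  shareVertex? : Decidable ShareVertex
  shareVertex? e f = any? λ x →
    ((x ≟ fst e) ⊎-dec (x ≟ snd e)) ×-dec ((x ≟ fst f) ⊎-dec (x ≟ snd f))

  _≟ᴱ_ : DecidableEquality (Edge H)
  edge a b _ _ ≟ᴱ edge c d _ _ with a ≟ c | b ≟ d
  ... | yes refl | yes refl = yes refl
  ... | no a≢c   | _        = no (a≢c ∘ cong fst)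
  ... | yes _    | no b≢d   = no (b≢d ∘ cong snd)

lineGraph : {n : ℕ} (H : Graph (Fin n)) → Graph (Edge H)
lineGraph H = record
  { _~_    = λ e f → e ≢ f × ShareVertex e f
  ; _~?_   = λ e f → ¬? (e ≟ᴱ f) ×-dec shareVertex? e f
  ; symm   = λ { (e≢f , x , x∈e , x∈f) → e≢f ∘ sym , x , x∈f , x∈e }
  ; irrefl = λ { e≡f (e≢f , _) → e≢f e≡f }
  }

record TransitiveOrientation {V : Set} (G : Graph V) : Set₁ where
  open Graph G
  infix 4 _⇾_
  field
    _⇾_     : Rel V 0ℓ
    ⇾⇒~     : ∀ {u v} → u ⇾ v → u ~ v
    orients : ∀ {u v} → u ~ v → u ⇾ v ⊎ v ⇾ u
    asym    : Asymmetric _⇾_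
    trans   : Transitive _⇾_

Comparability : {V : Set} → Graph V → Set₁
Comparability = TransitiveOrientation

-- The subgraphs are taken to be spanning: isolated vertices affect neither
-- the edge sets nor the existence of transitive orientations.
record ComparabilityPartition {V : Set} (G : Graph V) (m : ℕ) : Set₁ where
  open Graph
  field
    part          : Fin m → Graph V
    sub           : ∀ i {u v} → _~_ (part i) u v → _~_ G u v
    cover         : ∀ {u v} → _~_ G u v → ∃[ i ] _~_ (part i) u v
    disjoint      : ∀ {i j} → i ≢ j → ∀ {u v} → _~_ (part i) u v → ¬ _~_ (part j) u v
    comparability : ∀ i → Comparability (part i)

IsMinimum : (ℕ → Set₁) → ℕ → Set₁
IsMinimum P m = P m × (∀ k → P k → m ≤ k)

-- The graph of the partial function p.  A minimum need not exist
-- constructively for an arbitrary graph, so p is a relation here and its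
-- value has to be exhibited.
p[_]≡_ : {V : Set} → Graph V → ℕ → Set₁
p[ G ]≡ m = IsMinimum (ComparabilityPartition G) m

{-# OPTIONS --safe #-}

-- Fix one side of H and join two distinct edges of H when they meet at their
-- endpoint on that side.  This relation is a disjoint union of cliques, which
-- any linear order of the other endpoints orients transitively.  As two
-- distinct edges share at most one vertex, the two sides together partition
-- the edges of the line graph.
--
-- That p exists at all needs, constructively, a decision whether the line graph
-- is a comparability graph.  A transitive orientation of a decidable relation
-- is itself decidable, so on a finite vertex set it is a subset of a finite
-- list of pairs, and these subsets can be searched.
module Submission where

open import Data.Bool.Base using (Bool; true; false; not; if_then_else_)
open import Data.Bool.Properties as Bool using (¬-not)
open import Data.Empty using (⊥-elim-irr)
open import Data.Fin.Base using (Fin; zero; suc; _<_)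
open import Data.Fin.Properties using (<-cmp; <-irrefl; <-asym; <-trans; _<?_; _≟_)
open import Data.Fin.Subset as Subset using (Subset)
open import Data.Fin.Subset.Properties using (anySubset?; _∈?_)
open import Data.List.Base using (List; []; [_]; length; lookup; allFin; cartesianProduct; concatMap)
open import Data.List.Membership.Propositional using (_∈_; lose)
open import Data.List.Membership.Propositional.Properties
  using (∈-allFin; ∈-cartesianProduct⁺; ∈-concatMap⁺)
import Data.List.Relation.Unary.All as All
open import Data.List.Relation.Unary.Any using (here; index)
open import Data.List.Relation.Unary.Any.Properties using (lookup-index)
open import Data.Nat.Base using (ℕ; zero; suc; _≤_; z≤n; s≤s)
open import Data.Product.Base using (∃; ∃-syntax; _×_; _,_; proj₁; proj₂; uncurry)
open import Data.Sum.Base using (_⊎_; inj₁; inj₂; map)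
import Data.Vec.Base as Vec
open import Data.Vec.Properties using (lookup∘tabulate; []=⇒lookup; lookup⇒[]=)
open import Defs
open import Function.Base using (_∘_)
open import Function.Bundles using (_⇔_; mk⇔; Equivalence)
open import Level using (Level; 0ℓ)
open import Relation.Binary.Core using (Rel)
open import Relation.Binary.Definitions
  using (Decidable; tri<; tri≈; tri>)
open import Relation.Binary.PropositionalEquality
  using (_≡_; _≢_; refl; sym; trans; cong; subst)
open import Relation.Nullary.Decidable
  using (Dec; yes; no; does; map′; dec-true; ¬?; _×-dec_; _⊎-dec_; _→-dec_)
open import Relation.Nullary.Negation using (¬_; contradiction; contradiction-irr)
import Relation.Unary as Unary

open Edge

private
  variable
    ℓ : Level
    A V : Set
    n : ℕ

-- Exhaustive lists and codes for decidable predicates.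

record Listing (A : Set) : Set where
  field
    list     : List A
    complete : ∀ x → x ∈ list

open Listing

_×-listing_ : {B : Set} → Listing A → Listing B → Listing (A × B)
list     (L ×-listing M)         = cartesianProduct (list L) (list M)
complete (L ×-listing M) (x , y) = ∈-cartesianProduct⁺ (complete L x) (complete M y)

module _ (L : Listing A) where

  ∀? : {P : A → Set ℓ} → Unary.Decidable P → Dec (∀ x → P x)
  ∀? P? = map′ (λ ps x → All.lookup ps (complete L x)) (λ f → All.universal f _)
    (All.all? P? (list L))

  Code : Set
  Code = Subset (length (list L))

  -- A code is read at the one position that `complete` assigns to `x`. The list may contain `x`
  -- again, but bits at other occurrences are ignored.
  ⟦_⟧ : Code → A → Set
  ⟦ s ⟧ x = index (complete L x) Subset.∈ s

  encode : {P : A → Set ℓ} → Unary.Decidable P → ∃[ s ] (∀ x → ⟦ s ⟧ x ⇔ P x)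
  encode {P = P} P? = s , λ x → mk⇔ (to x) (from x)
    where
    s : Code
    s = Vec.tabulate (does ∘ P? ∘ lookup (list L))

    lookup-s : ∀ x → Vec.lookup s (index (complete L x)) ≡ does (P? x)
    lookup-s x = trans (lookup∘tabulate _ (index (complete L x)))
      (cong (does ∘ P?) (sym (lookup-index (complete L x))))

    does⇒ : ∀ x → does (P? x) ≡ true → P x
    does⇒ x eq with yes p ← P? x = p

    to : ∀ x → ⟦ s ⟧ x → P x
    to x x∈s = does⇒ x (trans (sym (lookup-s x)) ([]=⇒lookup x∈s))

    from : ∀ x → P x → ⟦ s ⟧ x
    from x p = lookup⇒[]= _ s (trans (lookup-s x) (dec-true (P? x) p))

-- Deciding comparability and the existence of partitions into zero or one part.

module _ (G : Graph V) where
  open Graph G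

  -- The laws of a transitive orientation with explicit quantifiers, so that `∀?` can decide each of
  -- them over a listing.
  Orients : Rel V 0ℓ → Set
  Orients R =
    (∀ u v → R u v → u ~ v) ×
    (∀ u v → u ~ v → R u v ⊎ R v u) ×
    (∀ u v → R u v → ¬ R v u) ×
    (∀ u v w → R u v → R v w → R u w)

  orients⇒comparability : {R : Rel V 0ℓ} → Orients R → Comparability G
  orients⇒comparability {R} (sound , total , asym , trans) = record
    { _⇾_ = R ; ⇾⇒~ = sound _ _ ; orients = total _ _
    ; asym = asym _ _ ; trans = trans _ _ _ }

  -- On an edge, `orients` already returns one of the two directions, and asymmetry refutes the
  -- other.
  ⇾-decidable : (C : Comparability G) → Decidable (TransitiveOrientation._⇾_ C)
  ⇾-decidable C u v with u ~? v
  ... | no u≁v = no (u≁v ∘ TransitiveOrientation.⇾⇒~ C)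
  ... | yes u~v with TransitiveOrientation.orients C u~v
  ...   | inj₁ u⇾v = yes u⇾v
  ...   | inj₂ v⇾u = no (TransitiveOrientation.asym C v⇾u)

  module _ (L : Listing V) where

    private
      L² : Listing (V × V)
      L² = L ×-listing L

      rel : Code L² → Rel V 0ℓ
      rel s u v = ⟦ L² ⟧ s (u , v)

    orients? : Unary.Decidable (Orients ∘ rel)
    orients? s =
      (∀? L λ u → ∀? L λ v → rel? u v →-dec (u ~? v)) ×-dec
      (∀? L λ u → ∀? L λ v → (u ~? v) →-dec (rel? u v ⊎-dec rel? v u)) ×-dec
      (∀? L λ u → ∀? L λ v → rel? u v →-dec ¬? (rel? v u)) ×-dec
      (∀? L λ u → ∀? L λ v → ∀? L λ w → rel? u v →-dec (rel? v w →-dec rel? u w))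
      where
      rel? : Decidable (rel s)
      rel? u v = index (complete L² (u , v)) ∈? s

    comparability⇒orients : Comparability G → ∃ (Orients ∘ rel)
    comparability⇒orients C = code ,
      (λ _ _ → ⇾⇒~ ∘ to) ,
      (λ _ _ → map from from ∘ orients) ,
      (λ _ _ r r′ → asym (to r) (to r′)) ,
      (λ _ _ _ r r′ → from (TransitiveOrientation.trans C (to r) (to r′)))
      where
      open TransitiveOrientation C hiding (trans)

      encoded = encode L² {P = uncurry _⇾_} (uncurry (⇾-decidable C))
      code = proj₁ encoded

      to : ∀ {u v} → rel code u v → u ⇾ v
      to = Equivalence.to (proj₂ encoded _)

      from : ∀ {u v} → u ⇾ v → rel code u v
      from = Equivalence.from (proj₂ encoded _)

    comparability? : Dec (Comparability G)
    comparability? = map′ (λ (_ , o) → orients⇒comparability o) comparability⇒orients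
      (anySubset? orients?)

  partition₀? : Listing V → Dec (ComparabilityPartition G 0)
  partition₀? L = map′ to from (∀? L λ u → ∀? L λ v → ¬? (u ~? v))
    where
    to : _ → ComparabilityPartition G 0
    to edgeless = record
      { part = λ () ; sub = λ () ; cover = λ u~v → contradiction u~v (edgeless _ _)
      ; disjoint = λ { {()} } ; comparability = λ () }

    from : ComparabilityPartition G 0 → _
    from P u v u~v with () ← proj₁ (ComparabilityPartition.cover P u~v)

  -- By `sub` and `cover` the only part has exactly the edges of `G`, so an orientation of one is an
  -- orientation of the other.
  partition₁? : Listing V → Dec (ComparabilityPartition G 1)
  partition₁? L = map′ to from (comparability? L)
    where
    to : Comparability G → ComparabilityPartition G 1
    to C = record
      { part = λ _ → G ; sub = λ _ u~v → u~v ; cover = zero ,_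
      ; disjoint = λ { {zero} {zero} 0≢0 → contradiction refl 0≢0 }
      ; comparability = λ _ → C }

    from : ComparabilityPartition G 1 → Comparability G
    from P = record
      { _⇾_     = _⇾_
      ; ⇾⇒~     = sub zero ∘ ⇾⇒~
      ; orients = λ u~v → case₁ (cover u~v)
      ; asym    = asym
      ; trans   = TransitiveOrientation.trans (comparability zero) }
      where
      open ComparabilityPartition P
      open TransitiveOrientation (comparability zero) hiding (trans)

      case₁ : ∀ {u v} → ∃[ i ] Graph._~_ (part i) u v → u ⇾ v ⊎ v ⇾ u
      case₁ (zero , u~v) = orients u~v

-- Since 2 is known to work, only 0 and 1 need to be tested to find the least value.
minimum≤2 : {P : ℕ → Set₁} → Dec (P 0) → Dec (P 1) → P 2 →
  ∃[ m ] (IsMinimum P m × m ≤ 2)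
minimum≤2 (yes p₀) _ _ = 0 , (p₀ , λ _ _ → z≤n) , z≤n
minimum≤2 (no ¬p₀) (yes p₁) _ = 1 , (p₁ , lower) , s≤s z≤n
  where
  lower : ∀ k → _ → 1 ≤ k
  lower zero    p = contradiction p ¬p₀
  lower (suc _) _ = s≤s z≤n
minimum≤2 (no ¬p₀) (no ¬p₁) p₂ = 2 , (p₂ , lower) , s≤s (s≤s z≤n)
  where
  lower : ∀ k → _ → 2 ≤ k
  lower 0             p = contradiction p ¬p₀
  lower 1             p = contradiction p ¬p₁
  lower (suc (suc _)) _ = s≤s (s≤s z≤n)

-- Listing and comparing the edges of a finite graph.

module _ (H : Graph (Fin n)) where
  open Graph H

  edgesBetween : Fin n → Fin n → List (Edge H)
  edgesBetween a b with a <? b | a ~? b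
  ... | yes a<b | yes a~b = [ edge a b a<b a~b ]
  ... | _       | _       = []

  ∈-edgesBetween : (e : Edge H) → e ∈ edgesBetween (fst e) (snd e)
  ∈-edgesBetween (edge a b a<b a~b) with a <? b | a ~? b
  -- The proofs found by the tests need not be those stored in the edge; irrelevance lets `refl`
  -- identify the two edges.
  ... | yes _  | yes _  = here refl
  ... | yes _  | no a≁b = contradiction-irr a~b a≁b
  ... | no a≮b | _      = contradiction-irr a<b a≮b

  edges : Listing (Edge H)
  list     edges   = concatMap (uncurry edgesBetween) (cartesianProduct (allFin n) (allFin n))
  complete edges e = ∈-concatMap⁺ (uncurry edgesBetween)
    (lose (∈-cartesianProduct⁺ (∈-allFin (fst e)) (∈-allFin (snd e))) (∈-edgesBetween e))

-- The increasing order of endpoints leaves only the matching case: sending both to one endpoint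
-- would give `a < a`, and swapping them would reverse the order.
⊆ᴱ⇒≡ : {H : Graph (Fin n)} {e f : Edge H} →
  (∀ {x} → x ∈ᴱ e → x ∈ᴱ f) → e ≡ f
⊆ᴱ⇒≡ {e = edge a b a<b _} {edge c d c<d _} e⊆f
  with e⊆f (inj₁ refl) | e⊆f (inj₂ refl)
... | inj₁ refl | inj₂ refl = refl
... | inj₁ refl | inj₁ refl = contradiction-irr a<b (<-irrefl refl)
... | inj₂ refl | inj₂ refl = contradiction-irr a<b (<-irrefl refl)
... | inj₂ refl | inj₁ refl = ⊥-elim-irr (<-asym a<b c<d)

-- The two-part partition of the line graph.

module _ {H : Graph (Fin n)} (bipartite : Bipartite H) where
  open Graph H

  private
    side : Fin n → Bool
    side = proj₁ bipartite

    proper : ∀ {u v} → u ~ v → side u ≢ side v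
    proper = proj₂ bipartite

  -- The endpoint on side `c`: if `fst e` lies on the other side, properness puts `snd e` on side
  -- `c`.
  end : Bool → Edge H → Fin n
  end c e = if does (side (fst e) Bool.≟ c) then fst e else snd e

  end-∈ᴱ : ∀ c e → end c e ∈ᴱ e
  end-∈ᴱ c e with does (side (fst e) Bool.≟ c)
  ... | true  = inj₁ refl
  ... | false = inj₂ refl

  ∈ᴱ⇒end : ∀ {x} e → x ∈ᴱ e → end (side x) e ≡ x
  ∈ᴱ⇒end e (inj₁ refl) with side (fst e) Bool.≟ side (fst e)
  ... | yes _  = refl
  ... | no s≢s = contradiction refl s≢s
  ∈ᴱ⇒end (edge a b _ a~b) (inj₂ refl) with side a Bool.≟ side b
  ... | yes s≡s = ⊥-elim-irr (proper a~b s≡s)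
  ... | no _    = refl

  -- Each endpoint `x` of `e` is the end of `e` on `side x`. The ends agree on both sides, so `x` is
  -- an endpoint of `f` too.
  end-injective : ∀ c {e f} → end c e ≡ end c f → end (not c) e ≡ end (not c) f → e ≡ f
  end-injective c {e} {f} eq eq′ = ⊆ᴱ⇒≡ λ {x} x∈e →
    subst (_∈ᴱ f) (trans (sym (agree (side x))) (∈ᴱ⇒end e x∈e)) (end-∈ᴱ (side x) f)
    where
    agree : ∀ d → end d e ≡ end d f
    agree d with d Bool.≟ c
    ... | yes refl = eq
    ... | no d≢c rewrite ¬-not d≢c = eq′

  meetAt : Bool → Graph (Edge H)
  meetAt c = record
    { _~_    = λ e f → e ≢ f × end c e ≡ end c f
    ; _~?_   = λ e f → ¬? (e ≟ᴱ f) ×-dec (end c e ≟ end c f)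
    ; symm   = λ (e≢f , eq) → e≢f ∘ sym , sym eq
    ; irrefl = λ e≡f (e≢f , _) → e≢f e≡f
    }

  meetAt-comparability : ∀ c → Comparability (meetAt c)
  meetAt-comparability c = record
    { _⇾_     = λ e f → end c e ≡ end c f × end (not c) e < end (not c) f
    ; ⇾⇒~     = λ (eq , lt) → (λ { refl → <-irrefl refl lt }) , eq
    ; orients = orients
    ; asym    = λ (_ , lt) (_ , gt) → <-asym lt gt
    ; trans   = λ (eq , lt) (eq′ , lt′) → trans eq eq′ , <-trans lt lt′
    }
    where
    orients : ∀ {e f} → e ≢ f × end c e ≡ end c f → _
    orients {e} {f} (e≢f , eq) with <-cmp (end (not c) e) (end (not c) f)
    ... | tri< lt _ _  = inj₁ (eq , lt)
    -- Distinct edges with a common end on side `c` have different other ends, so the order never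
    -- ties.
    ... | tri≈ _ eq′ _ = contradiction (end-injective c eq eq′) e≢f
    ... | tri> _ _ gt  = inj₂ (sym eq , gt)

  partition₂ : ComparabilityPartition (lineGraph H) 2
  partition₂ = record
    { part          = meetAt ∘ colour
    ; sub           = λ i {e} {f} (e≢f , eq) → e≢f ,
        end (colour i) e , end-∈ᴱ (colour i) e ,
        subst (_∈ᴱ f) (sym eq) (end-∈ᴱ (colour i) f)
    -- The side of the shared vertex selects the part.
    ; cover         = λ {e} {f} (e≢f , x , x∈e , x∈f) →
        cover (side x) (e≢f , trans (∈ᴱ⇒end e x∈e) (sym (∈ᴱ⇒end f x∈f)))
    ; disjoint      = disjoint
    ; comparability = meetAt-comparability ∘ colour
    }
    where
    colour : Fin 2 → Bool
    colour zero       = false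
    colour (suc zero) = true

    cover : ∀ c {e f} → Graph._~_ (meetAt c) e f →
      ∃[ i ] Graph._~_ (meetAt (colour i)) e f
    cover false e~f = zero , e~f
    cover true  e~f = suc zero , e~f

    disjoint : ∀ {i j} → i ≢ j → ∀ {e f} →
      Graph._~_ (meetAt (colour i)) e f → Graph._~_ (meetAt (colour j)) e f → _
    disjoint {zero}     {zero}     i≢j _ _ = i≢j refl
    -- The other colour computes to `not false`, so `eq` and `eq′` give equal ends on both sides.
    disjoint {zero}     {suc zero} _ (e≢f , eq) (_ , eq′) = e≢f (end-injective false eq eq′)
    disjoint {suc zero} {zero}     _ (e≢f , eq) (_ , eq′) = e≢f (end-injective true eq eq′)
    disjoint {suc zero} {suc zero} i≢j _ _ = i≢j refl

theorem4 : (n : ℕ) (H : Graph (Fin n)) → Bipartite H →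
    ∃[ m ] (p[ lineGraph H ]≡ m × m ≤ 2)
theorem4 n H bip = minimum≤2
  (partition₀? (lineGraph H) (edges H))
  (partition₁? (lineGraph H) (edges H))
  (partition₂ bip)
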